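{- For every integer $n \geq 1$, the Euler numbers $E_{2j}$ satisfy $$\sum_{j=0}^{n} \binom{2n}{2j}\, E_{2j} = 0.$$
   Context: The Euler numbers $(E_n)_{n\ge 0}$ are the unique sequence of numbers satisfying $$\frac{2}{e^x+e^{ -x}} = \sum_{n=0}^{\infty} \frac{E_n}{n!}\,x^n .$$ -}

module Defs where

open import Algebra.Properties.Group using (∙-cancelʳ)
open import Data.Fin using (Fin; zero; suc; toℕ)
open import Data.Fin.Properties using (toℕ<n)
open import Data.Integer as ℤ using (ℤ; 1ℤ; -1ℤ)
open import Data.Nat as ℕ using (ℕ; zero; suc; _∸_; _!)
open import Data.Nat.Induction using (<-rec)
open import Data.Nat.Properties as ℕ using (∸-monoʳ-<; _!≢0)
open import Data.Product using (∃!; _,_; proj₁)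
open import Data.Rational as ℚ using (ℚ; NonZero; 0ℚ; 1ℚ; 1/_; _/_; _+_; _-_; _*_)
open import Data.Rational.Properties
open import Data.Rational.Unnormalised as ℚᵘ using (mkℚᵘ)
import Data.Rational.Unnormalised.Properties as ℚᵘ
open import Data.Vec.Functional using (Vector)
open import Function using (_$_)
open import Relation.Binary.PropositionalEquality
open ≡-Reasoning

open import Algebra.Properties.CommutativeMonoid.Sum +-0-commutativeMonoid

-- Formal power series over ℚ: f n is the coefficient of xⁿ, and equality of
-- series is _≗_.
Series : Set
Series = ℕ → ℚ

const : ℚ → Series
const c zero    = c
const c (suc _) = 0ℚ

infixl 6 _⊕_
infixl 7 _⊛_

_⊕_ : Series → Series → Series
(f ⊕ g) n = f n + g n

_⊛_ : Series → Series → Series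
(f ⊛ g) n = ∑[ i ≤ n ] (f (toℕ i) * g (n ∸ toℕ i))

1/_! : ℕ → ℚ
1/ n ! = (ℤ.+ 1 / (n !)) {{n !≢0}}

-- ∑ aₙ xⁿ / n!
egf : (ℕ → ℚ) → Series
egf a n = a n * 1/ n !

-- exp c is e^(c x).
exp : ℤ → Series
exp c = egf λ n → c ℤ.^ n / 1

-- 2 / (eˣ + e⁻ˣ) = ∑ Eₙ xⁿ / n!, where the quotient of two series is the
-- series whose product with the denominator is the numerator.
IsEulerNumbers : (ℕ → ℚ) → Set
IsEulerNumbers E = (exp 1ℤ ⊕ exp -1ℤ) ⊛ egf E ≗ const (ℤ.+ 2 / 1)

module _ (f : Series) {{_ : NonZero (f 0)}} where

  module _ (h : Series) where

    -- quotient-prefix n lists the first n coefficients of the quotient, the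
    -- latest first.
    quotient        : Series
    quotient-prefix : ∀ n → Vector ℚ n

    quotient n =
      1/ f 0 * (h n - ∑[ i < n ] (f (suc (toℕ i)) * quotient-prefix n i))

    quotient-prefix (suc n) zero    = quotient n
    quotient-prefix (suc n) (suc i) = quotient-prefix n i

    quotient-prefix-lookup :
      ∀ n i → quotient (n ∸ suc (toℕ i)) ≡ quotient-prefix n i
    quotient-prefix-lookup (suc n) zero    = refl
    quotient-prefix-lookup (suc n) (suc i) = quotient-prefix-lookup n i

    ⊛-quotient : f ⊛ quotient ≗ h
    ⊛-quotient n = begin
      f 0 * quotient n + ∑[ i < n ] (f (suc (toℕ i)) * quotient (n ∸ suc (toℕ i)))
        ≡⟨ cong (f 0 * quotient n +_) $ sum-cong-≗ {n} (λ i →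
             cong (f (suc (toℕ i)) *_) (quotient-prefix-lookup n i)) ⟩
      f 0 * (1/ f 0 * (h n - S)) + S
        ≡⟨ cong (_+ S) (*-assoc (f 0) (1/ f 0) (h n - S)) ⟨
      f 0 * 1/ f 0 * (h n - S) + S
        ≡⟨ cong (λ u → u * (h n - S) + S) (*-inverseʳ (f 0)) ⟩
      1ℚ * (h n - S) + S
        ≡⟨ cong (_+ S) (*-identityˡ (h n - S)) ⟩
      h n - S + S
        ≡⟨ +-assoc (h n) (ℚ.- S) S ⟩
      h n + (ℚ.- S + S)
        ≡⟨ cong (h n +_) (+-inverseˡ S) ⟩
      h n + 0ℚ
        ≡⟨ +-identityʳ (h n) ⟩
      h n ∎
      where
      S : ℚ
      S = ∑[ i < n ] (f (suc (toℕ i)) * quotient-prefix n i)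

  *-cancelˡ-f₀ : ∀ {p q} → f 0 * p ≡ f 0 * q → p ≡ q
  *-cancelˡ-f₀ {p} {q} eq = begin
    p                  ≡⟨ unit p ⟨
    1/ f 0 * (f 0 * p) ≡⟨ cong (1/ f 0 *_) eq ⟩
    1/ f 0 * (f 0 * q) ≡⟨ unit q ⟩
    q                  ∎
    where
    unit : ∀ r → 1/ f 0 * (f 0 * r) ≡ r
    unit r = begin
      1/ f 0 * (f 0 * r) ≡⟨ *-assoc (1/ f 0) (f 0) r ⟨
      1/ f 0 * f 0 * r   ≡⟨ cong (_* r) (*-inverseˡ (f 0)) ⟩
      1ℚ * r             ≡⟨ *-identityˡ r ⟩
      r                  ∎

  ⊛-cancelˡ : ∀ g h → f ⊛ g ≗ f ⊛ h → g ≗ h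
  ⊛-cancelˡ g h eq = <-rec (λ n → g n ≡ h n) step
    where
    tail : Series → ℕ → ℚ
    tail k n = ∑[ i < n ] (f (suc (toℕ i)) * k (n ∸ suc (toℕ i)))

    step : ∀ n → (∀ {m} → m ℕ.< n → g m ≡ h m) → g n ≡ h n
    step n ih = *-cancelˡ-f₀ $ ∙-cancelʳ +-0-group (tail g n) _ _ $ begin
      f 0 * g n + tail g n ≡⟨ eq n ⟩
      f 0 * h n + tail h n ≡⟨ cong (f 0 * h n +_) tails ⟨
      f 0 * h n + tail g n ∎
      where
      tails : tail g n ≡ tail h n
      tails = sum-cong-≗ {n} λ i →
        cong (f (suc (toℕ i)) *_) (ih (∸-monoʳ-< (ℕ.s≤s ℕ.z≤n) (toℕ<n i)))

n!*1/n! : ∀ n → (ℤ.+ (n !) / 1) * 1/ n ! ≡ 1ℚ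
n!*1/n! n = helper (n !) {{n !≢0}}
  where
  helper : ∀ d .{{_ : ℕ.NonZero d}} → (ℤ.+ d / 1) * (ℤ.+ 1 / d) ≡ 1ℚ
  helper d@(suc d-1) = toℚᵘ-injective $ ℚᵘ.≃-trans
    (toℚᵘ-homo-* (ℤ.+ d / 1) (ℤ.+ 1 / d))
    (ℚᵘ.≃-trans
      (ℚᵘ.*-cong (toℚᵘ-fromℚᵘ (mkℚᵘ (ℤ.+ d) 0)) (toℚᵘ-fromℚᵘ (mkℚᵘ (ℤ.+ 1) d-1)))
      (ℚᵘ.*-inverseʳ (mkℚᵘ (ℤ.+ d) 0)))

eulerNumbers-∃! : ∃! _≗_ IsEulerNumbers
eulerNumbers-∃! = E₀ , isEuler , unique
  where
  d q : Series
  d = exp 1ℤ ⊕ exp -1ℤ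
  q = quotient d (const (ℤ.+ 2 / 1))

  E₀ : ℕ → ℚ
  E₀ n = q n * (ℤ.+ (n !) / 1)

  egf-E₀ : egf E₀ ≗ q
  egf-E₀ n = begin
    q n * (ℤ.+ (n !) / 1) * 1/ n !   ≡⟨ *-assoc (q n) _ _ ⟩
    q n * ((ℤ.+ (n !) / 1) * 1/ n !) ≡⟨ cong (q n *_) (n!*1/n! n) ⟩
    q n * 1ℚ                         ≡⟨ *-identityʳ (q n) ⟩
    q n                              ∎

  isEuler : IsEulerNumbers E₀
  isEuler n = trans
    (sum-cong-≗ {suc n} λ i → cong (d (toℕ i) *_) (egf-E₀ (n ∸ toℕ i)))
    (⊛-quotient d (const (ℤ.+ 2 / 1)) n)

  unique : ∀ {E} → IsEulerNumbers E → E₀ ≗ E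
  unique {E} e n = begin
    q n * (ℤ.+ (n !) / 1)            ≡⟨ cong (_* (ℤ.+ (n !) / 1)) (⊛-cancelˡ d q (egf E) q≗ n) ⟩
    E n * 1/ n ! * (ℤ.+ (n !) / 1)   ≡⟨ *-assoc (E n) _ _ ⟩
    E n * (1/ n ! * (ℤ.+ (n !) / 1)) ≡⟨ cong (E n *_) (trans (*-comm (1/ n !) _) (n!*1/n! n)) ⟩
    E n * 1ℚ                         ≡⟨ *-identityʳ (E n) ⟩
    E n                              ∎
    where
    q≗ : d ⊛ q ≗ d ⊛ egf E
    q≗ m = trans (⊛-quotient d (const (ℤ.+ 2 / 1)) m) (sym (e m))

eulerNumber : ℕ → ℚ
eulerNumber = proj₁ eulerNumbers-∃!

{-# OPTIONS --safe #-}
module Submission where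

open import Defs
open import Algebra.Bundles using (module CommutativeRing)
open import Data.Fin using (toℕ)
open import Data.Fin.Permutation using (reverse)
open import Data.Fin.Properties using (opposite-prop; toℕ≤pred[n])
open import Data.Integer as ℤ using (+_; 1ℤ; -1ℤ)
import Data.Integer.Properties as ℤ
open import Data.Nat as ℕ using (ℕ; zero; suc; _≥_; _∸_; _!)
open import Data.Nat.Combinatorics using (_C_; nCk≡nC[n∸k]; nCk≡n!/k![n-k]!; k![n∸k]!∣n!)
open import Data.Nat.DivMod using (m/n*n≡m)
import Data.Nat.Properties as ℕ
open import Data.Product using (proj₁; proj₂)
open import Data.Rational as ℚ using (ℚ; _/_; _+_; _*_; 0ℚ; 1ℚ; ½)
open import Data.Rational.Properties
  using ( +-0-commutativeMonoid; +-*-commutativeRing; toℚᵘ-injective; toℚᵘ-homo-*; toℚᵘ-fromℚᵘ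
        ; +-identityˡ; *-identityˡ; *-zeroˡ; *-zeroʳ)
open import Data.Rational.Solver using (module +-*-Solver)
open import Data.Rational.Unnormalised using (mkℚᵘ; *≡*)
import Data.Rational.Unnormalised.Properties as ℚᵘ
open import Algebra.Properties.CommutativeMonoid.Sum +-0-commutativeMonoid using (sum⁺-syntax; sum-cong-≗; sum-permute)
open import Algebra.Properties.Semiring.Sum (CommutativeRing.semiring +-*-commutativeRing) using (*-distribˡ-sum)
open import Relation.Binary.PropositionalEquality using (_≡_; refl; sym; trans; cong; cong₂; module ≡-Reasoning)
open ≡-Reasoning
open +-*-Solver using (solve; con; _:+_; _:*_; _:=_)

-- Multiply the generating function of the Euler numbers by `eˣ+e⁻ˣ`: the product is the constant 2,
-- so its coefficient of degree 2n vanishes for n ≥ 1. In `eˣ+e⁻ˣ` the odd coefficients cancel and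
-- the even ones double, which leaves ∑ 2/(2j)! · E₂ₙ₋₂ⱼ/(2n-2j)! = 0. Scaling by (2n)!/2 turns the
-- factorials into binomial coefficients (`nCk≡n!*1/k!*1/[n∸k]!`), and substituting n - j for j
-- gives the claim.

-- Needed because the Cauchy product attaches E to the complementary index 2n - 2j, whereas the
-- theorem attaches it to 2j.
∑-reverse : ∀ (f : ℕ → ℚ) n → ∑[ i ≤ n ] f (toℕ i) ≡ ∑[ i ≤ n ] f (n ∸ toℕ i)
∑-reverse f n = trans
  (sum-permute {suc n} (λ i → f (toℕ i)) reverse)
  (sum-cong-≗ {suc n} λ i → cong f (opposite-prop i))

-- Induction on `n` for all `f` at once: split off `f 0` and the vanishing `f 1`, then apply the
-- hypothesis to `f` shifted by two.
∑-even : ∀ (f : ℕ → ℚ) → (∀ j → f (suc (2 ℕ.* j)) ≡ 0ℚ) →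
  ∀ n → ∑[ i ≤ 2 ℕ.* n ] f (toℕ i) ≡ ∑[ j ≤ n ] f (2 ℕ.* toℕ j)
∑-even f odd zero    = refl
∑-even f odd (suc n) = begin
  ∑[ i ≤ 2 ℕ.* suc n ] f (toℕ i)
    ≡⟨ cong (λ m → ∑[ i ≤ m ] f (toℕ i)) (ℕ.*-suc 2 n) ⟩
  f 0 + (f 1 + ∑[ i ≤ 2 ℕ.* n ] f (2 ℕ.+ toℕ i))
    ≡⟨ cong (λ x → f 0 + (x + ∑[ i ≤ 2 ℕ.* n ] f (2 ℕ.+ toℕ i))) (odd 0) ⟩
  f 0 + (0ℚ + ∑[ i ≤ 2 ℕ.* n ] f (2 ℕ.+ toℕ i))
    ≡⟨ cong (f 0 ℚ.+_) (+-identityˡ _) ⟩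
  f 0 + ∑[ i ≤ 2 ℕ.* n ] f (2 ℕ.+ toℕ i)
    ≡⟨ cong (f 0 ℚ.+_) (∑-even (λ i → f (2 ℕ.+ i)) odd′ n) ⟩
  f 0 + ∑[ j ≤ n ] f (2 ℕ.+ 2 ℕ.* toℕ j)
    ≡⟨ cong (f 0 ℚ.+_) (sum-cong-≗ {suc n} λ j → cong f (ℕ.*-suc 2 (toℕ j))) ⟨
  f 0 + ∑[ j ≤ n ] f (2 ℕ.* suc (toℕ j)) ∎
  where
  odd′ : ∀ j → f (2 ℕ.+ suc (2 ℕ.* j)) ≡ 0ℚ
  odd′ j = trans (cong (λ m → f (suc m)) (sym (ℕ.*-suc 2 j))) (odd (suc j))

-- `_/_` reduces fractions to lowest terms, so the identity is checked on unnormalised rationals,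
-- where all denominators are 1.
/1-homo-* : ∀ m n → + (m ℕ.* n) / 1 ≡ (+ m / 1) * (+ n / 1)
/1-homo-* m n = toℚᵘ-injective (ℚᵘ.≃-trans
  (toℚᵘ-fromℚᵘ (mkℚᵘ (+ (m ℕ.* n)) 0))
  (ℚᵘ.≃-sym (ℚᵘ.≃-trans (toℚᵘ-homo-* (+ m / 1) (+ n / 1))
    (ℚᵘ.≃-trans
      (ℚᵘ.*-cong (toℚᵘ-fromℚᵘ (mkℚᵘ (+ m) 0)) (toℚᵘ-fromℚᵘ (mkℚᵘ (+ n) 0)))
      (*≡* (cong (ℤ._* + 1) (sym (ℤ.pos-* m n))))))))

nCk*[k!*[n∸k]!]≡n! : ∀ {n k} → k ℕ.≤ n → (n C k) ℕ.* (k ! ℕ.* (n ∸ k) !) ≡ n !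
nCk*[k!*[n∸k]!]≡n! {n} {k} k≤n =
  trans (cong (ℕ._* (k ! ℕ.* (n ∸ k) !)) (nCk≡n!/k![n-k]! k≤n)) (m/n*n≡m (k![n∸k]!∣n! k≤n))
  where instance _ = k ℕ.!* (n ∸ k) !≢0

-- Insert 1 = k! · 1/k! and 1 = (n-k)! · 1/(n-k)! and regroup; the factorials then combine with the
-- binomial coefficient into n!.
nCk≡n!*1/k!*1/[n∸k]! : ∀ {n k} → k ℕ.≤ n →
  + (n C k) / 1 ≡ (+ (n !) / 1) * (1/ k ! * 1/ (n ∸ k) !)
nCk≡n!*1/k!*1/[n∸k]! {n} {k} k≤n = begin
  c                          ≡⟨ solve 1 (λ c → c := c :* (con 1ℚ :* con 1ℚ)) refl c ⟩
  c * (1ℚ * 1ℚ)              ≡⟨ cong₂ (λ x y → c * (x * y)) (n!*1/n! k) (n!*1/n! (n ∸ k)) ⟨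
  c * (a * 1/ k ! * (b * 1/ (n ∸ k) !))
    ≡⟨ solve 5 (λ c a b v w → c :* (a :* v :* (b :* w)) := c :* (a :* b) :* (v :* w)) refl
         c a b (1/ k !) (1/ (n ∸ k) !) ⟩
  c * (a * b) * (1/ k ! * 1/ (n ∸ k) !)
    ≡⟨ cong (_* (1/ k ! * 1/ (n ∸ k) !)) n!≡ ⟨
  (+ (n !) / 1) * (1/ k ! * 1/ (n ∸ k) !) ∎
  where
  c a b : ℚ
  c = + (n C k) / 1
  a = + (k !) / 1
  b = + ((n ∸ k) !) / 1

  n!≡ : + (n !) / 1 ≡ c * (a * b)
  n!≡ = begin
    + (n !) / 1                                  ≡⟨ cong (λ m → + m / 1) (nCk*[k!*[n∸k]!]≡n! k≤n) ⟨
    + ((n C k) ℕ.* (k ! ℕ.* (n ∸ k) !)) / 1        ≡⟨ /1-homo-* (n C k) (k ! ℕ.* (n ∸ k) !) ⟩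
    c * (+ (k ! ℕ.* (n ∸ k) !) / 1)              ≡⟨ cong (c *_) (/1-homo-* (k !) ((n ∸ k) !)) ⟩
    c * (a * b)                                  ∎

-1^even : ∀ j → -1ℤ ℤ.^ (2 ℕ.* j) ≡ 1ℤ
-1^even j = trans (sym (ℤ.^-*-assoc -1ℤ 2 j)) (ℤ.^-zeroˡ j)

eˣ+e⁻ˣ : Series
eˣ+e⁻ˣ = exp 1ℤ ⊕ exp -1ℤ

eˣ+e⁻ˣ-even : ∀ j → eˣ+e⁻ˣ (2 ℕ.* j) ≡ 1/ (2 ℕ.* j) ! + 1/ (2 ℕ.* j) !
eˣ+e⁻ˣ-even j = cong₂ _+_ (coeff (ℤ.^-zeroˡ (2 ℕ.* j))) (coeff (-1^even j))
  where
  coeff : ∀ {c} → c ≡ 1ℤ → c / 1 * 1/ (2 ℕ.* j) ! ≡ 1/ (2 ℕ.* j) !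
  coeff refl = *-identityˡ (1/ (2 ℕ.* j) !)

eˣ+e⁻ˣ-odd : ∀ j → eˣ+e⁻ˣ (suc (2 ℕ.* j)) ≡ 0ℚ
eˣ+e⁻ˣ-odd j = begin
  eˣ+e⁻ˣ k
    ≡⟨ cong₂ (λ c d → c / 1 * 1/ k ! + d / 1 * 1/ k !) (ℤ.^-zeroˡ k) (cong (-1ℤ ℤ.*_) (-1^even j)) ⟩
  1ℚ * 1/ k ! + (-1ℤ / 1) * 1/ k !
    ≡⟨ solve 1 (λ v → con 1ℚ :* v :+ con (-1ℤ / 1) :* v := con 0ℚ) refl (1/ k !) ⟩
  0ℚ ∎
  where
  k : ℕ
  k = suc (2 ℕ.* j)

-- The coefficient of x²ⁿ in (eˣ + e⁻ˣ) ∑ Eₖ xᵏ/k! vanishes, and only the even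
-- powers of x in eˣ + e⁻ˣ contribute to it; (2n)!/2 times that coefficient is
-- the sum below, read backwards.
∑-binomial-even : ∀ {E} → IsEulerNumbers E → ∀ n → n ≥ 1 →
  ∑[ j ≤ n ] ((+ ((2 ℕ.* n) C (2 ℕ.* toℕ j)) / 1) * E (2 ℕ.* toℕ j)) ≡ 0ℚ
∑-binomial-even {E} isEuler n@(suc _) _ = begin
  ∑[ j ≤ n ] term (toℕ j)               ≡⟨ ∑-reverse term n ⟩
  ∑[ j ≤ n ] term (n ∸ toℕ j)           ≡⟨ sum-cong-≗ {suc n} (λ j → term-reverse (toℕ j) (toℕ≤pred[n] j)) ⟩
  ∑[ j ≤ n ] (s * coeff (2 ℕ.* toℕ j))  ≡⟨ *-distribˡ-sum {suc n} s (λ j → coeff (2 ℕ.* toℕ j)) ⟨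
  s * ∑[ j ≤ n ] coeff (2 ℕ.* toℕ j)    ≡⟨ cong (s *_) (∑-even coeff coeff-odd n) ⟨
  -- Here n ≥ 1 enters: since `n` is a successor, so is `2n`, and `const (+ 2 / 1) 2n` computes to
  -- `0ℚ`.
  s * ∑[ i ≤ 2n ] coeff (toℕ i)         ≡⟨ cong (s *_) (isEuler 2n) ⟩
  s * 0ℚ                                ≡⟨ *-zeroʳ s ⟩
  0ℚ                                    ∎
  where
  2n : ℕ
  2n = 2 ℕ.* n

  s : ℚ
  s = (+ (2n !) / 1) * ½

  term coeff : ℕ → ℚ
  term j  = (+ (2n C (2 ℕ.* j)) / 1) * E (2 ℕ.* j)
  coeff i = eˣ+e⁻ˣ i * egf E (2n ∸ i)

  coeff-odd : ∀ j → coeff (suc (2 ℕ.* j)) ≡ 0ℚ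
  coeff-odd j = trans (cong (_* egf E (2n ∸ suc (2 ℕ.* j))) (eˣ+e⁻ˣ-odd j)) (*-zeroˡ (egf E (2n ∸ suc (2 ℕ.* j))))

  term-reverse : ∀ j → j ℕ.≤ n → term (n ∸ j) ≡ s * coeff (2 ℕ.* j)
  term-reverse j j≤n = begin
    (+ (2n C (2 ℕ.* (n ∸ j))) / 1) * E (2 ℕ.* (n ∸ j))
      ≡⟨ cong (λ m → (+ (2n C m) / 1) * E m) (ℕ.*-distribˡ-∸ 2 n j) ⟩
    (+ (2n C l) / 1) * E l
      -- By symmetry the lower index becomes `k`, so that the factorial formula yields exactly
      -- `1/ k !` and `1/ l !`.
      ≡⟨ cong (λ m → (+ m / 1) * E l) (nCk≡nC[n∸k] k≤2n) ⟨
    (+ (2n C k) / 1) * E l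
      ≡⟨ cong (_* E l) (nCk≡n!*1/k!*1/[n∸k]! k≤2n) ⟩
    (+ (2n !) / 1) * (1/ k ! * 1/ l !) * E l
      -- The `½` in `s` absorbs the doubling of `1/ k !` that comes from adding the two
      -- exponentials.
      ≡⟨ solve 4 (λ f v w e → f :* (v :* w) :* e := f :* con ½ :* ((v :+ v) :* (e :* w))) refl
           (+ (2n !) / 1) (1/ k !) (1/ l !) (E l) ⟩
    s * ((1/ k ! + 1/ k !) * egf E l)
      ≡⟨ cong (λ d → s * (d * egf E l)) (eˣ+e⁻ˣ-even j) ⟨
    s * coeff k ∎
    where
    k l : ℕ
    k = 2 ℕ.* j
    l = 2n ∸ k

    k≤2n : k ℕ.≤ 2n
    k≤2n = ℕ.*-monoʳ-≤ 2 j≤n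

theorem1p2 : ∀ (n : ℕ) → n ≥ 1 →
    ∑[ j ≤ n ] ((+ ((2 ℕ.* n) C (2 ℕ.* toℕ j)) / 1) * eulerNumber (2 ℕ.* toℕ j)) ≡ 0ℚ
theorem1p2 = ∑-binomial-even {eulerNumber} (proj₁ (proj₂ eulerNumbers-∃!))
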